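{- Let $1\le \ell\le m$ be integers, let $k=\binom{m}{\ell}$ and $\nu:=\binom{m-1}{\ell-1}$. Given $\Lambda\subseteq I_\ell[m]$, consider the complement $\Lambda^{c}:=I_\ell[m]\setminus\Lambda$. Then $\Lambda$ is a subclose family in $I_\ell[m]$ if and only if $\Lambda^{c}$ is a subclose family in $I_\ell[m]$. Moreover, with $r:=|\Lambda|$, $$K_{\Lambda^c}=m\binom{\nu}{2}-r\ell(\nu-1)+K_\Lambda.$$ Consequently, $$K_{k-r}(\ell,m)=m\binom{\nu}{2}-r\ell(\nu-1)+K_r(\ell,m)\quad\text{for } 0\le r\le k.$$
   Context: $[m]:=\{1,\dots,m\}$, and $I_\ell[m]$ denotes the set of all subsets of $[m]$ of cardinality $\ell$. For $\Lambda=\{A_1,\dots,A_r\}\subseteq I_\ell[m]$ with $|\Lambda|=r$ (the $A_i$ distinct), put $K_\Lambda:=\sum_{1\le i<j\le r}|A_i\cap A_j|$. For an integer $0\le r\le k=\binom{m}{\ell}$, put $K_r(\ell,m):=\max\{K_\Lambda : \Lambda\subseteq I_\ell[m],\ |\Lambda|=r\}$. A family $\Lambda\subseteq I_\ell[m]$ is called subclose if $K_\Lambda=K_r(\ell,m)$, where $r=|\Lambda|$. -}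

module Defs where

open import Data.Bool.Properties using () renaming (_≟_ to _≟ᵇ_)
open import Data.Fin.Subset using (Subset; inside; outside; ∣_∣; _∩_)
open import Data.Fin.Subset.Properties using (∩-comm)
open import Data.List using (List; []; _∷_; [_]; _++_; map; filter; length)
open import Data.Nat.ListAction using (sum)
open import Data.Nat.ListAction.Properties using (sum-↭)
open import Data.List.Extrema.Nat using (max; xs≤max; argmax-sel)
open import Data.List.Membership.Propositional using (_∈_)
open import Data.List.Membership.Propositional.Properties
  using (∈-map⁺; ∈-map⁻; ∈-++⁺ˡ; ∈-++⁺ʳ; ∈-++⁻; ∈-filter⁺; ∈-filter⁻)
open import Data.List.Membership.Propositional.Properties.WithK using (unique∧set⇒bag)
open import Data.List.Relation.Binary.BagAndSetEquality using (∼bag⇒↭)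
open import Data.List.Relation.Binary.Permutation.Propositional
  using (_↭_; refl; prep; swap; trans)
open import Data.List.Relation.Binary.Permutation.Propositional.Properties
  using (map⁺; ↭-length)
open import Data.List.Relation.Binary.Sublist.Propositional using (_⊆_; []; _∷_; _∷ʳ_; minimum)
open import Data.List.Relation.Binary.Sublist.Propositional.Properties
  using (All-resp-⊆; filter-⊆)
open import Data.List.Relation.Unary.All as All using (All)
open import Data.List.Relation.Unary.All.Properties using (all-filter)
open import Data.List.Relation.Unary.AllPairs using ([]; _∷_)
open import Data.List.Relation.Unary.Any using (here)
open import Data.List.Relation.Unary.Unique.Propositional using (Unique)
import Data.List.Relation.Unary.Unique.Propositional.Properties as Unique
open import Data.Nat using (ℕ; zero; suc; _+_; _≤_; z≤n; _≟_)
open import Data.Nat.Properties using (≤-antisym; module ≤-Reasoning; ≤-reflexive; ≤-trans; +-assoc; +-comm)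
open import Data.Product using (∃-syntax; _×_; _,_; proj₁; proj₂)
open import Data.Sum using (inj₁; inj₂)
open import Data.Vec using ([]; _∷_)
open import Data.Vec.Properties using (≡-dec; ∷-injectiveʳ)
open import Function using (id; mk⇔)
open import Relation.Binary.Definitions using (DecidableEquality)
open import Relation.Binary.PropositionalEquality as ≡
  using (_≡_; refl; sym; cong; cong₂; subst; module ≡-Reasoning)

_≟ˢ_ : ∀ {m} → DecidableEquality (Subset m)
_≟ˢ_ = ≡-dec _≟ᵇ_

module _ {m : ℕ} where
  open import Data.List.Membership.DecPropositional (_≟ˢ_ {m}) public
    using (_∈?_; _∉?_)

allSubsets : ∀ m → List (Subset m)
allSubsets zero    = [ [] ]
allSubsets (suc m) = map (inside ∷_) (allSubsets m) ++ map (outside ∷_) (allSubsets m)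

I : ∀ ℓ m → List (Subset m)
I ℓ m = filter (λ A → ∣ A ∣ ≟ ℓ) (allSubsets m)

∈-allSubsets : ∀ {m} (A : Subset m) → A ∈ allSubsets m
∈-allSubsets []            = here refl
∈-allSubsets (inside  ∷ A) = ∈-++⁺ˡ (∈-map⁺ (inside ∷_) (∈-allSubsets A))
∈-allSubsets (outside ∷ A) =
  ∈-++⁺ʳ (map (inside ∷_) (allSubsets _)) (∈-map⁺ (outside ∷_) (∈-allSubsets A))

allSubsets-unique : ∀ m → Unique (allSubsets m)
allSubsets-unique zero    = All.[] ∷ []
allSubsets-unique (suc m) =
  Unique.++⁺ (Unique.map⁺ ∷-injectiveʳ (allSubsets-unique m))
             (Unique.map⁺ ∷-injectiveʳ (allSubsets-unique m))
             disjoint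
  where
  disjoint : ∀ {A} → A ∈ map (inside ∷_) (allSubsets m) ×
                     A ∈ map (outside ∷_) (allSubsets m) → _
  disjoint (p , q) with ∈-map⁻ (inside ∷_) p | ∈-map⁻ (outside ∷_) q
  ... | _ , _ , refl | _ , _ , ()

∈-I : ∀ {ℓ m} {A : Subset m} → ∣ A ∣ ≡ ℓ → A ∈ I ℓ m
∈-I {ℓ} {A = A} = ∈-filter⁺ (λ B → ∣ B ∣ ≟ ℓ) (∈-allSubsets A)

I-unique : ∀ ℓ m → Unique (I ℓ m)
I-unique ℓ m = Unique.filter⁺ (λ A → ∣ A ∣ ≟ ℓ) (allSubsets-unique m)

-- A set Λ = {A₁, …, Aᵣ} ⊆ I ℓ m of pairwise distinct members.  The order of
-- the list is immaterial to every notion below (see listK-↭).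
record Family (ℓ m : ℕ) : Set where
  field
    members  : List (Subset m)
    distinct : Unique members
    sizes    : All (λ A → ∣ A ∣ ≡ ℓ) members

open Family public

size : ∀ {ℓ m} → Family ℓ m → ℕ
size Λ = length (members Λ)

infix 8 _ᶜ

_ᶜ : ∀ {ℓ m} → Family ℓ m → Family ℓ m
_ᶜ {ℓ} {m} Λ = record
  { members  = filter (_∉? members Λ) (I ℓ m)
  ; distinct = Unique.filter⁺ (_∉? members Λ) (I-unique ℓ m)
  ; sizes    = All-resp-⊆ (filter-⊆ (_∉? members Λ) (I ℓ m))
                          (all-filter (λ A → ∣ A ∣ ≟ ℓ) (allSubsets m))
  }

-- The sum of ∣ Aᵢ ∩ Aⱼ ∣ over all i < j.
listK : ∀ {m} → List (Subset m) → ℕ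
listK []       = 0
listK (A ∷ As) = sum (map (λ B → ∣ A ∩ B ∣) As) + listK As

K : ∀ {ℓ m} → Family ℓ m → ℕ
K Λ = listK (members Λ)

-- All length-r sublists of a list.
choose : ∀ {a} {A : Set a} → ℕ → List A → List (List A)
choose zero    _        = [ [] ]
choose (suc r) []       = []
choose (suc r) (x ∷ xs) = map (x ∷_) (choose r xs) ++ choose (suc r) xs

-- The maximum of K over the families of size r; that it is one is shown by
-- K≤maxK and maxK-attained.  For r larger than the length of I ℓ m, where there
-- is no such family, it takes the junk value 0.
maxK : ℕ → ℕ → ℕ → ℕ
maxK r ℓ m = max 0 (map listK (choose r (I ℓ m)))

Subclose : ∀ {ℓ m} → Family ℓ m → Set
Subclose {ℓ} {m} Λ = K Λ ≡ maxK (size Λ) ℓ m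

listK-↭ : ∀ {m} {As Bs : List (Subset m)} → As ↭ Bs → listK As ≡ listK Bs
listK-↭ refl          = refl
listK-↭ (prep A p)    = cong₂ _+_ (sum-↭ (map⁺ (λ B → ∣ A ∩ B ∣) p)) (listK-↭ p)
listK-↭ (trans p q)   = ≡.trans (listK-↭ p) (listK-↭ q)
listK-↭ (swap {As} {Bs} A B p) = begin
  (∣ A ∩ B ∣ + s A As) + (s B As + listK As)
    ≡⟨ cong₂ (λ x y → (∣ x ∣ + s A As) + y) (∩-comm A B) refl ⟩
  (∣ B ∩ A ∣ + s A As) + (s B As + listK As)
    ≡⟨ +-assoc ∣ B ∩ A ∣ (s A As) _ ⟩
  ∣ B ∩ A ∣ + (s A As + (s B As + listK As))
    ≡⟨ cong (∣ B ∩ A ∣ +_) (sym (+-assoc (s A As) (s B As) _)) ⟩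
  ∣ B ∩ A ∣ + ((s A As + s B As) + listK As)
    ≡⟨ cong (λ x → ∣ B ∩ A ∣ + (x + listK As)) (+-comm (s A As) (s B As)) ⟩
  ∣ B ∩ A ∣ + ((s B As + s A As) + listK As)
    ≡⟨ cong (∣ B ∩ A ∣ +_) (+-assoc (s B As) (s A As) _) ⟩
  ∣ B ∩ A ∣ + (s B As + (s A As + listK As))
    ≡⟨ sym (+-assoc ∣ B ∩ A ∣ (s B As) _) ⟩
  (∣ B ∩ A ∣ + s B As) + (s A As + listK As)
    ≡⟨ cong₂ (λ x y → (∣ B ∩ A ∣ + x) + y)
             (sum-↭ (map⁺ (λ C → ∣ B ∩ C ∣) p))
             (cong₂ _+_ (sum-↭ (map⁺ (λ C → ∣ A ∩ C ∣) p)) (listK-↭ p)) ⟩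
  (∣ B ∩ A ∣ + s B Bs) + (s A Bs + listK Bs) ∎
  where
  open ≡-Reasoning
  s = λ C Cs → sum (map (λ D → ∣ C ∩ D ∣) Cs)

∈-choose⁺ : ∀ {a} {A : Set a} {xs ys : List A} → xs ⊆ ys → xs ∈ choose (length xs) ys
∈-choose⁺ {xs = []}                   _          = here refl
∈-choose⁺ {xs = x ∷ xs} {ys = y ∷ ys} (.y ∷ʳ p)  =
  ∈-++⁺ʳ (map (y ∷_) (choose (length xs) ys)) (∈-choose⁺ p)
∈-choose⁺ {xs = x ∷ xs}               (refl ∷ p) = ∈-++⁺ˡ (∈-map⁺ (x ∷_) (∈-choose⁺ p))

∈-choose⁻ : ∀ {a} {A : Set a} r (ys : List A) {xs} →
            xs ∈ choose r ys → xs ⊆ ys × length xs ≡ r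
∈-choose⁻ zero    ys       (here refl) = minimum ys , refl
∈-choose⁻ (suc r) (y ∷ ys) p with ∈-++⁻ (map (y ∷_) (choose r ys)) p
... | inj₂ q = let s , e = ∈-choose⁻ (suc r) ys q in y ∷ʳ s , e
... | inj₁ q with ∈-map⁻ (y ∷_) q
...   | _ , q′ , refl = let s , e = ∈-choose⁻ r ys q′ in refl ∷ s , cong suc e

Unique-resp-⊆ : ∀ {a} {A : Set a} {xs ys : List A} → xs ⊆ ys → Unique ys → Unique xs
Unique-resp-⊆ []         _        = []
Unique-resp-⊆ (_ ∷ʳ p)   (_ ∷ us) = Unique-resp-⊆ p us
Unique-resp-⊆ (refl ∷ p) (u ∷ us) = All-resp-⊆ p u ∷ Unique-resp-⊆ p us

K≤maxK : ∀ {ℓ m} (Λ : Family ℓ m) → K Λ ≤ maxK (size Λ) ℓ m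
K≤maxK {ℓ} {m} Λ = begin
  K Λ                    ≡⟨ listK-↭ Λ↭As ⟩
  listK As               ≤⟨ All.lookup (xs≤max 0 _) (∈-map⁺ listK (∈-choose⁺ As⊆I)) ⟩
  maxK (length As) ℓ m   ≡⟨ cong (λ r → maxK r ℓ m) (sym (↭-length Λ↭As)) ⟩
  maxK (size Λ) ℓ m      ∎
  where
  open ≤-Reasoning
  As = filter (_∈? members Λ) (I ℓ m)
  As⊆I : As ⊆ I ℓ m
  As⊆I = filter-⊆ (_∈? members Λ) (I ℓ m)
  Λ↭As : members Λ ↭ As
  Λ↭As = ∼bag⇒↭ (unique∧set⇒bag (distinct Λ)
    (Unique.filter⁺ (_∈? members Λ) (I-unique ℓ m))
    (mk⇔ (λ p → ∈-filter⁺ (_∈? members Λ) (∈-I (All.lookup (sizes Λ) p)) p)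
         (λ p → proj₂ (∈-filter⁻ (_∈? members Λ) {xs = I ℓ m} p))))

maxK-attained : ∀ {ℓ m} (Λ : Family ℓ m) →
                ∃[ Λ′ ] size Λ′ ≡ size Λ × K {ℓ} {m} Λ′ ≡ maxK (size Λ) ℓ m
maxK-attained {ℓ} {m} Λ with argmax-sel id 0 (map listK (choose (size Λ) (I ℓ m)))
... | inj₁ max≡0 = Λ , refl , ≤-antisym (K≤maxK Λ) (≤-trans (≤-reflexive max≡0) z≤n)
... | inj₂ max∈ with ∈-map⁻ listK max∈
...   | As , As∈ , eq =
  let As⊆I , len = ∈-choose⁻ (size Λ) (I ℓ m) As∈ in
  record { members  = As
         ; distinct = Unique-resp-⊆ As⊆I (I-unique ℓ m)
         ; sizes    = All-resp-⊆ As⊆I (all-filter (λ A → ∣ A ∣ ≟ ℓ) (allSubsets m)) }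
  , len , sym eq

{-# OPTIONS --safe #-}

-- Write ν for the number of members of I ℓ m containing a given point.  Every
-- A of cardinality ℓ meets the members of I ℓ m in ℓ ν points altogether, so
-- the total overlap of Λ with I ℓ m is r ℓ ν.  The part of it inside Λ is
-- 2 K Λ + r ℓ, which determines the overlap of Λ with Λ ᶜ, and splitting
-- K (I ℓ m) along Λ and Λ ᶜ then expresses K (Λ ᶜ) as K Λ plus a quantity
-- depending on r only.
module Submission where

open import Defs
open import Data.Nat using (ℕ; _≤_; _∸_)
open import Data.Nat.Combinatorics using (_C_)
open import Data.Product using (_×_; _,_)
open import Function using (_⇔_)
open import Relation.Binary.PropositionalEquality using (_≡_)

module Counting where

  open import Data.Nat using (zero; suc; _+_; _*_; _≟_)
  open import Data.Nat.Properties
    using ( +-assoc; *-zeroʳ; *-distribˡ-+; *-assoc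
          ; +-cancelʳ-≡; +-cancelˡ-≡; *-cancelˡ-≡; +-monoˡ-≤; +-monoʳ-≤
          ; ≤-antisym; suc-injective; m+n∸m≡n; m≤n⇒m⊓n≡m; +-commutativeSemigroup
          ; module ≤-Reasoning)
  open import Algebra.Properties.CommutativeSemigroup +-commutativeSemigroup
    using (interchange; x∙yz≈y∙xz)
  open import Data.Nat.Combinatorics using (nCk+nC[k+1]≡[n+1]C[k+1]; nC1≡n)
  open import Data.Nat.ListAction using (sum)
  open import Data.Nat.ListAction.Properties using (sum-++; sum-↭)
  open import Data.Nat.Tactic.RingSolver using (solve-∀)
  open import Data.Fin.Subset using (Subset; inside; outside; ∣_∣; _∩_; ⊤)
  open import Data.Fin.Subset.Properties using (∩-comm; ∩-idem; ∩-identityˡ; ∣⊤∣≡n)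
  open import Data.List using (List; []; _∷_; _++_; map; filter; length; take)
  open import Data.List.Properties
    using (map-++; map-∘; filter-++; filter-≐; filter-none; length-map; length-++; length-take)
  open import Data.List.Membership.Propositional using (_∈_; _∉_)
  open import Data.List.Membership.Propositional.Properties
    using (∈-++⁺ˡ; ∈-++⁺ʳ; ∈-++⁻; ∈-filter⁺; ∈-filter⁻)
  open import Data.List.Membership.Propositional.Properties.WithK using (unique∧set⇒bag)
  open import Data.List.Relation.Binary.BagAndSetEquality using (∼bag⇒↭)
  open import Data.List.Relation.Binary.Permutation.Propositional using (_↭_; ↭-trans)
  open import Data.List.Relation.Binary.Permutation.Propositional.Properties
    using (map⁺; ↭-length; ++-comm)
  open import Data.List.Relation.Unary.All as All using (All; []; _∷_)
  import Data.List.Relation.Unary.All.Properties as All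
  import Data.List.Relation.Unary.Unique.Propositional.Properties as Unique
  open import Data.Sum using (inj₁; inj₂)
  open import Data.Product using (proj₁; proj₂)
  open import Data.Vec using ([]; _∷_)
  open import Function using (mk⇔; _∘_)
  open import Relation.Nullary using (yes; no; does)
  open import Data.Bool using (true; false)
  open import Relation.Unary using (Pred; Decidable)
  open import Relation.Binary.PropositionalEquality
    using (refl; sym; trans; cong; cong₂; subst; module ≡-Reasoning)

  -- Overlap sums over lists of subsets.

  overlaps : ∀ {m} → Subset m → List (Subset m) → ℕ
  overlaps A Bs = sum (map (λ B → ∣ A ∩ B ∣) Bs)

  crossK : ∀ {m} → List (Subset m) → List (Subset m) → ℕ
  crossK []       Bs = 0
  crossK (A ∷ As) Bs = overlaps A Bs + crossK As Bs

  overlaps-++ : ∀ {m} (A : Subset m) Bs Cs →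
               overlaps A (Bs ++ Cs) ≡ overlaps A Bs + overlaps A Cs
  overlaps-++ A Bs Cs =
    trans (cong sum (map-++ (λ B → ∣ A ∩ B ∣) Bs Cs)) (sum-++ (map _ Bs) (map _ Cs))

  overlaps-↭ : ∀ {m} (A : Subset m) {Bs Cs} → Bs ↭ Cs → overlaps A Bs ≡ overlaps A Cs
  overlaps-↭ A p = sum-↭ (map⁺ (λ B → ∣ A ∩ B ∣) p)

  crossK-++ʳ : ∀ {m} (As Bs Cs : List (Subset m)) →
               crossK As (Bs ++ Cs) ≡ crossK As Bs + crossK As Cs
  crossK-++ʳ []       Bs Cs = refl
  crossK-++ʳ (A ∷ As) Bs Cs
    rewrite overlaps-++ A Bs Cs | crossK-++ʳ As Bs Cs =
    interchange (overlaps A Bs) (overlaps A Cs) (crossK As Bs) (crossK As Cs)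

  -- `crossK` recurses on its left argument only. Peeling the right one as well is what the
  -- induction for `crossK As As` needs, since there both arguments grow together.
  crossK-∷ʳ : ∀ {m} (As : List (Subset m)) B Bs →
              crossK As (B ∷ Bs) ≡ overlaps B As + crossK As Bs
  crossK-∷ʳ []       B Bs = refl
  crossK-∷ʳ (A ∷ As) B Bs
    rewrite crossK-∷ʳ As B Bs | ∩-comm A B =
    interchange ∣ B ∩ A ∣ (overlaps A Bs) (overlaps B As) (crossK As Bs)

  crossK-const : ∀ {m c} {As Bs : List (Subset m)} →
                 All (λ A → overlaps A Bs ≡ c) As → crossK As Bs ≡ length As * c
  crossK-const []       = refl
  crossK-const (e ∷ es) = cong₂ _+_ e (crossK-const es)

  -- Among ordered pairs from `As`, each pair of distinct positions occurs in both orders, and each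
  -- diagonal pair contributes `∣ A ∩ A ∣`, which is `ℓ`.
  crossK-self : ∀ {m ℓ} {As : List (Subset m)} → All (λ A → ∣ A ∣ ≡ ℓ) As →
                crossK As As ≡ 2 * listK As + length As * ℓ
  crossK-self []                          = refl
  crossK-self {ℓ = ℓ} {A ∷ As} (refl ∷ es)
    rewrite crossK-∷ʳ As A As | crossK-self es | ∩-idem A =
    rearrange ∣ A ∣ (overlaps A As) (listK As) (length As)
    where
    rearrange : ∀ a s k n →
                (a + s) + (s + (2 * k + n * a)) ≡ 2 * (s + k) + (a + n * a)
    rearrange = solve-∀

  -- A pair of positions lies within `As`, within `Bs`, or has one position in each.
  listK-++ : ∀ {m} (As Bs : List (Subset m)) →
             listK (As ++ Bs) ≡ listK As + crossK As Bs + listK Bs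
  listK-++ []       Bs = refl
  listK-++ (A ∷ As) Bs
    rewrite overlaps-++ A As Bs | listK-++ As Bs =
    rearrange (overlaps A As) (overlaps A Bs) (listK As) (crossK As Bs) (listK Bs)
    where
    rearrange : ∀ a b c d e → (a + b) + (c + d + e) ≡ (a + c) + (b + d) + e
    rearrange = solve-∀

  -- Recursive structure and length of the list of all sets of cardinality `ℓ`.

  filter-map : ∀ {a b p} {A : Set a} {B : Set b} {P : Pred B p}
               (P? : Decidable P) (f : A → B) xs →
               filter P? (map f xs) ≡ map f (filter (P? ∘ f) xs)
  filter-map P? f []       = refl
  filter-map P? f (x ∷ xs) with does (P? (f x))
  ... | true  = cong (f x ∷_) (filter-map P? f xs)
  ... | false = filter-map P? f xs

  I-zero : ∀ m → I 0 (suc m) ≡ map (outside ∷_) (I 0 m)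
  I-zero m = begin
    I 0 (suc m)
      ≡⟨ filter-++ _ (map (inside ∷_) (allSubsets m)) _ ⟩
    filter _ (map (inside ∷_) (allSubsets m)) ++ filter _ (map (outside ∷_) (allSubsets m))
      ≡⟨ cong₂ _++_ (filter-none _ (All.map⁺ (All.universal (λ _ ()) (allSubsets m))))
                    (filter-map _ (outside ∷_) (allSubsets m)) ⟩
    map (outside ∷_) (I 0 m) ∎
    where open ≡-Reasoning

  -- Pascal's recursion at the level of lists, splitting by whether the first point belongs to the
  -- set. It drives the inductions for `length-I` and `overlaps-I`.
  I-suc : ∀ ℓ m →
          I (suc ℓ) (suc m) ≡ map (inside ∷_) (I ℓ m) ++ map (outside ∷_) (I (suc ℓ) m)
  I-suc ℓ m = begin
    I (suc ℓ) (suc m)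
      ≡⟨ filter-++ _ (map (inside ∷_) (allSubsets m)) _ ⟩
    filter _ (map (inside ∷_) (allSubsets m)) ++ filter _ (map (outside ∷_) (allSubsets m))
      ≡⟨ cong₂ _++_ (filter-map _ (inside ∷_) (allSubsets m))
                    (filter-map _ (outside ∷_) (allSubsets m)) ⟩
    map (inside ∷_) (filter (λ A → suc ∣ A ∣ ≟ suc ℓ) (allSubsets m)) ++ _
      ≡⟨ cong (λ As → map (inside ∷_) As ++ map (outside ∷_) (I (suc ℓ) m))
              (filter-≐ _ _ (suc-injective , cong suc) (allSubsets m)) ⟩
    map (inside ∷_) (I ℓ m) ++ map (outside ∷_) (I (suc ℓ) m) ∎
    where open ≡-Reasoning

  length-I : ∀ ℓ m → length (I ℓ m) ≡ m C ℓ
  length-I zero    zero    = refl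
  length-I (suc ℓ) zero    = refl
  length-I zero    (suc m) = begin
    length (I 0 (suc m))               ≡⟨ cong length (I-zero m) ⟩
    length (map (outside ∷_) (I 0 m))  ≡⟨ length-map _ (I 0 m) ⟩
    length (I 0 m)                     ≡⟨ length-I 0 m ⟩
    m C 0                              ∎
    where open ≡-Reasoning
  length-I (suc ℓ) (suc m) = begin
    length (I (suc ℓ) (suc m))
      ≡⟨ cong length (I-suc ℓ m) ⟩
    length (map (inside ∷_) (I ℓ m) ++ map (outside ∷_) (I (suc ℓ) m))
      ≡⟨ length-++ (map (inside ∷_) (I ℓ m)) ⟩
    length (map (inside ∷_) (I ℓ m)) + length (map (outside ∷_) (I (suc ℓ) m))
      ≡⟨ cong₂ _+_ (trans (length-map _ (I ℓ m)) (length-I ℓ m))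
                   (trans (length-map _ (I (suc ℓ) m)) (length-I (suc ℓ) m)) ⟩
    m C ℓ + m C suc ℓ
      ≡⟨ nCk+nC[k+1]≡[n+1]C[k+1] m ℓ ⟩
    suc m C suc ℓ ∎
    where open ≡-Reasoning

  I-sizes : ∀ ℓ m → All (λ A → ∣ A ∣ ≡ ℓ) (I ℓ m)
  I-sizes ℓ m = All.all-filter (λ A → ∣ A ∣ ≟ ℓ) (allSubsets m)

  -- Overlap of a single set with all sets of cardinality `ℓ`.

  -- The number ν of the paper, corrected at ℓ = 0, where the binomial
  -- coefficient with truncated subtraction would give 1 instead of 0.
  degree : ℕ → ℕ → ℕ
  degree zero    m = 0
  degree (suc ℓ) m = (m ∸ 1) C ℓ

  -- Pascal's rule for the degrees. The factor `∣ A ∣` covers `m = 0`: there `m ∸ 1` truncates and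
  -- the bare identity fails at `ℓ = 1`, but `A` is empty and both sides vanish.
  degree-pascal : ∀ ℓ {m} (A : Subset m) →
                  ∣ A ∣ * degree ℓ m + ∣ A ∣ * degree (suc ℓ) m ≡ ∣ A ∣ * (m C ℓ)
  degree-pascal ℓ       []              = refl
  degree-pascal zero    A@(_ ∷ _)       = cong (_+ ∣ A ∣ * 1) (*-zeroʳ ∣ A ∣)
  degree-pascal (suc ℓ) {suc m} A@(_ ∷ _) =
    trans (sym (*-distribˡ-+ ∣ A ∣ (m C ℓ) (m C suc ℓ)))
          (cong (∣ A ∣ *_) (nCk+nC[k+1]≡[n+1]C[k+1] m ℓ))

  -- The split on `s` lets the first bit of the intersection compute. With `outside` on the left, as
  -- in `overlaps-outsideˡ`, it computes without a split.
  overlaps-outsideʳ : ∀ {m} s (A : Subset m) Bs →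
                     overlaps (s ∷ A) (map (outside ∷_) Bs) ≡ overlaps A Bs
  overlaps-outsideʳ s       A []       = refl
  overlaps-outsideʳ inside  A (B ∷ Bs) = cong (∣ A ∩ B ∣ +_) (overlaps-outsideʳ inside A Bs)
  overlaps-outsideʳ outside A (B ∷ Bs) = cong (∣ A ∩ B ∣ +_) (overlaps-outsideʳ outside A Bs)

  overlaps-outsideˡ : ∀ {m} t (A : Subset m) Bs →
                     overlaps (outside ∷ A) (map (t ∷_) Bs) ≡ overlaps A Bs
  overlaps-outsideˡ t A Bs = cong sum (sym (map-∘ Bs))

  overlaps-inside : ∀ {m} (A : Subset m) Bs →
                   overlaps (inside ∷ A) (map (inside ∷_) Bs) ≡ length Bs + overlaps A Bs
  overlaps-inside A []       = refl
  overlaps-inside A (B ∷ Bs) rewrite overlaps-inside A Bs =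
    cong suc (x∙yz≈y∙xz ∣ A ∩ B ∣ (length Bs) (overlaps A Bs))

  -- Each point of `A` lies in `degree ℓ m` members of `I ℓ m`. The count is done by induction on
  -- `m` along `I-suc`: if the first point is in `A`, it adds one for each of the `m C ℓ` members
  -- containing it, and the remaining points are combined by `degree-pascal`.
  overlaps-I : ∀ ℓ {m} (A : Subset m) → overlaps A (I ℓ m) ≡ ∣ A ∣ * degree ℓ m
  overlaps-I zero    []              = refl
  overlaps-I (suc ℓ) []              = refl
  overlaps-I zero    {suc m} (s ∷ A) = begin
    overlaps (s ∷ A) (I 0 (suc m))               ≡⟨ cong (overlaps (s ∷ A)) (I-zero m) ⟩
    overlaps (s ∷ A) (map (outside ∷_) (I 0 m))  ≡⟨ overlaps-outsideʳ s A (I 0 m) ⟩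
    overlaps A (I 0 m)                           ≡⟨ overlaps-I 0 A ⟩
    ∣ A ∣ * 0                                   ≡⟨ *-zeroʳ ∣ A ∣ ⟩
    0                                           ≡⟨ *-zeroʳ ∣ s ∷ A ∣ ⟨
    ∣ s ∷ A ∣ * 0                               ∎
    where open ≡-Reasoning
  overlaps-I (suc ℓ) {suc m} (s ∷ A) = begin
    overlaps (s ∷ A) (I (suc ℓ) (suc m))
      ≡⟨ cong (overlaps (s ∷ A)) (I-suc ℓ m) ⟩
    overlaps (s ∷ A) (map (inside ∷_) (I ℓ m) ++ map (outside ∷_) (I (suc ℓ) m))
      ≡⟨ overlaps-++ (s ∷ A) (map (inside ∷_) (I ℓ m)) _ ⟩
    overlaps (s ∷ A) (map (inside ∷_) (I ℓ m)) + overlaps (s ∷ A) (map (outside ∷_) (I (suc ℓ) m))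
      ≡⟨ cong (overlaps (s ∷ A) (map (inside ∷_) (I ℓ m)) +_)
              (trans (overlaps-outsideʳ s A (I (suc ℓ) m)) (overlaps-I (suc ℓ) A)) ⟩
    overlaps (s ∷ A) (map (inside ∷_) (I ℓ m)) + ∣ A ∣ * degree (suc ℓ) m
      ≡⟨ step s ⟩
    ∣ s ∷ A ∣ * (m C ℓ) ∎
    where
    open ≡-Reasoning
    step : ∀ s → overlaps (s ∷ A) (map (inside ∷_) (I ℓ m)) + ∣ A ∣ * degree (suc ℓ) m
                 ≡ ∣ s ∷ A ∣ * (m C ℓ)
    step outside = begin
      overlaps (outside ∷ A) (map (inside ∷_) (I ℓ m)) + ∣ A ∣ * degree (suc ℓ) m
        ≡⟨ cong (_+ ∣ A ∣ * degree (suc ℓ) m)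
                (trans (overlaps-outsideˡ inside A (I ℓ m)) (overlaps-I ℓ A)) ⟩
      ∣ A ∣ * degree ℓ m + ∣ A ∣ * degree (suc ℓ) m
        ≡⟨ degree-pascal ℓ A ⟩
      ∣ A ∣ * (m C ℓ) ∎
    step inside = begin
      overlaps (inside ∷ A) (map (inside ∷_) (I ℓ m)) + ∣ A ∣ * degree (suc ℓ) m
        ≡⟨ cong (_+ ∣ A ∣ * degree (suc ℓ) m)
                (trans (overlaps-inside A (I ℓ m)) (cong₂ _+_ (length-I ℓ m) (overlaps-I ℓ A))) ⟩
      m C ℓ + ∣ A ∣ * degree ℓ m + ∣ A ∣ * degree (suc ℓ) m
        ≡⟨ +-assoc (m C ℓ) _ _ ⟩
      m C ℓ + (∣ A ∣ * degree ℓ m + ∣ A ∣ * degree (suc ℓ) m)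
        ≡⟨ cong (m C ℓ +_) (degree-pascal ℓ A) ⟩
      m C ℓ + ∣ A ∣ * (m C ℓ) ∎

  crossK-I : ∀ {ℓ m} {As : List (Subset m)} → All (λ A → ∣ A ∣ ≡ ℓ) As →
             crossK As (I ℓ m) ≡ length As * (ℓ * degree ℓ m)
  crossK-I {ℓ} {m} es = crossK-const
    (All.map (λ {A} e → trans (overlaps-I ℓ A) (cong (_* degree ℓ m) e)) es)

  overlaps-⊤ : ∀ {m ℓ} {Bs : List (Subset m)} → All (λ B → ∣ B ∣ ≡ ℓ) Bs →
              overlaps ⊤ Bs ≡ length Bs * ℓ
  overlaps-⊤ []                       = refl
  overlaps-⊤ {Bs = B ∷ _} (e ∷ es) =
    cong₂ _+_ (trans (cong ∣_∣ (∩-identityˡ B)) e) (overlaps-⊤ es)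

  -- Both sides count the pairs x ∈ A ∈ I ℓ m, that is, the total overlap with ⊤.
  length-I*ℓ : ∀ ℓ m → length (I ℓ m) * ℓ ≡ m * degree ℓ m
  length-I*ℓ ℓ m = begin
    length (I ℓ m) * ℓ          ≡⟨ overlaps-⊤ (I-sizes ℓ m) ⟨
    overlaps ⊤ (I ℓ m)           ≡⟨ overlaps-I ℓ (⊤ {m}) ⟩
    ∣ ⊤ {m} ∣ * degree ℓ m      ≡⟨ cong (_* degree ℓ m) (∣⊤∣≡n m) ⟩
    m * degree ℓ m              ∎
    where open ≡-Reasoning

  -- The value of `listK` on all sets of cardinality `ℓ`.

  2*nC2+n≡n*n : ∀ n → 2 * (n C 2) + n ≡ n * n
  2*nC2+n≡n*n zero    = refl
  2*nC2+n≡n*n (suc n) = begin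
    2 * (suc n C 2) + suc n        ≡⟨ cong (λ x → 2 * x + suc n) (nCk+nC[k+1]≡[n+1]C[k+1] n 1) ⟨
    2 * (n C 1 + n C 2) + suc n    ≡⟨ cong (λ x → 2 * (x + n C 2) + suc n) (nC1≡n n) ⟩
    2 * (n + n C 2) + suc n        ≡⟨ expand n (n C 2) ⟩
    2 * (n C 2) + n + suc (n + n)  ≡⟨ cong (_+ suc (n + n)) (2*nC2+n≡n*n n) ⟩
    n * n + suc (n + n)            ≡⟨ square n ⟩
    suc n * suc n                  ∎
    where
    open ≡-Reasoning
    expand : ∀ n c → 2 * (n + c) + suc n ≡ 2 * c + n + suc (n + n)
    expand = solve-∀
    square : ∀ n → n * n + suc (n + n) ≡ suc n * suc n
    square = solve-∀

  -- Each of the `m` points is shared by `degree ℓ m C 2` pairs of members. Formally,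
  -- `crossK (I ℓ m) (I ℓ m)` is evaluated both by `crossK-self` and by `crossK-I`; the diagonal
  -- term `m * ν` and the factor 2 are then cancelled.
  listK-I : ∀ ℓ m → listK (I ℓ m) ≡ m * (degree ℓ m C 2)
  listK-I ℓ m = *-cancelˡ-≡ _ _ 2 (+-cancelʳ-≡ (m * ν) _ _ (begin
    2 * listK (I ℓ m) + m * ν                ≡⟨ cong (2 * listK (I ℓ m) +_) (length-I*ℓ ℓ m) ⟨
    2 * listK (I ℓ m) + length (I ℓ m) * ℓ   ≡⟨ crossK-self (I-sizes ℓ m) ⟨
    crossK (I ℓ m) (I ℓ m)                   ≡⟨ crossK-I (I-sizes ℓ m) ⟩
    length (I ℓ m) * (ℓ * ν)                 ≡⟨ *-assoc (length (I ℓ m)) ℓ ν ⟨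
    length (I ℓ m) * ℓ * ν                   ≡⟨ cong (_* ν) (length-I*ℓ ℓ m) ⟩
    m * ν * ν                                ≡⟨ *-assoc m ν ν ⟩
    m * (ν * ν)                              ≡⟨ cong (m *_) (2*nC2+n≡n*n ν) ⟨
    m * (2 * (ν C 2) + ν)                    ≡⟨ expand m (ν C 2) ν ⟩
    2 * (m * (ν C 2)) + m * ν                ∎))
    where
    open ≡-Reasoning
    ν = degree ℓ m
    expand : ∀ m c n → m * (2 * c + n) ≡ 2 * (m * c) + m * n
    expand = solve-∀

  -- Complementary families: sizes, overlaps and maxima.

  -- A relation up to permutation, so that it is symmetric: `Λ ᶜ ᶜ` lists its members in the order
  -- of `I ℓ m` and need not equal `Λ` as a list.
  Complementary : ∀ {ℓ m} → Family ℓ m → Family ℓ m → Set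
  Complementary {ℓ} {m} Λ Γ = members Λ ++ members Γ ↭ I ℓ m

  Complementary-sym : ∀ {ℓ m} (Λ Γ : Family ℓ m) → Complementary Λ Γ → Complementary Γ Λ
  Complementary-sym Λ Γ = ↭-trans (++-comm (members Γ) (members Λ))

  -- Both lists are free of repetitions and have the same elements, hence are permutations of each
  -- other.
  ᶜ-complementary : ∀ {ℓ m} (Λ : Family ℓ m) → Complementary Λ (Λ ᶜ)
  ᶜ-complementary {ℓ} {m} Λ = ∼bag⇒↭ (unique∧set⇒bag
    (Unique.++⁺ (distinct Λ) (distinct (Λ ᶜ)) (λ (p , q) → proj₂ (∈-ᶜ⁻ q) p))
    (I-unique ℓ m)
    (mk⇔ to from))
    where
    ∈-ᶜ⁻ : ∀ {A} → A ∈ members (Λ ᶜ) → A ∈ I ℓ m × A ∉ members Λ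
    ∈-ᶜ⁻ = ∈-filter⁻ (_∉? members Λ) {xs = I ℓ m}
    to : ∀ {A} → A ∈ members Λ ++ members (Λ ᶜ) → A ∈ I ℓ m
    to p with ∈-++⁻ (members Λ) p
    ... | inj₁ q = ∈-I (All.lookup (sizes Λ) q)
    ... | inj₂ q = proj₁ (∈-ᶜ⁻ q)
    from : ∀ {A} → A ∈ I ℓ m → A ∈ members Λ ++ members (Λ ᶜ)
    from {A} p with A ∈? members Λ
    ... | yes q = ∈-++⁺ˡ q
    ... | no ¬q = ∈-++⁺ʳ (members Λ) (∈-filter⁺ (_∉? members Λ) p ¬q)

  size-complementary : ∀ {ℓ m} (Λ Γ : Family ℓ m) → Complementary Λ Γ →
                       size Λ + size Γ ≡ m C ℓ
  size-complementary {ℓ} {m} Λ Γ p =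
    trans (sym (length-++ (members Λ))) (trans (↭-length p) (length-I ℓ m))

  -- K Γ = m (ν C 2) − r ℓ (ν − 1) + K Λ with the subtracted terms moved across.
  K-complementary : ∀ {ℓ m} (Λ Γ : Family ℓ m) → Complementary Λ Γ →
    K Γ + size Λ * (ℓ * degree ℓ m) ≡ m * (degree ℓ m C 2) + size Λ * ℓ + K Λ
  K-complementary {ℓ} {m} Λ Γ p = begin
    K Γ + size Λ * (ℓ * degree ℓ m)
      ≡⟨ cong (K Γ +_) (crossK-I (sizes Λ)) ⟨
    K Γ + crossK Λs (I ℓ m)
      ≡⟨ cong (K Γ +_) (crossK-↭ʳ Λs p) ⟨
    K Γ + crossK Λs (Λs ++ Γs)
      ≡⟨ cong (K Γ +_) (crossK-++ʳ Λs Λs Γs) ⟩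
    K Γ + (crossK Λs Λs + crossK Λs Γs)
      ≡⟨ cong (λ x → K Γ + (x + crossK Λs Γs)) (crossK-self (sizes Λ)) ⟩
    K Γ + (2 * K Λ + size Λ * ℓ + crossK Λs Γs)
      ≡⟨ rearrange (K Γ) (K Λ) (size Λ * ℓ) (crossK Λs Γs) ⟩
    K Λ + crossK Λs Γs + K Γ + size Λ * ℓ + K Λ
      ≡⟨ cong (λ x → x + size Λ * ℓ + K Λ) (listK-++ Λs Γs) ⟨
    listK (Λs ++ Γs) + size Λ * ℓ + K Λ
      ≡⟨ cong (λ x → x + size Λ * ℓ + K Λ) (trans (listK-↭ p) (listK-I ℓ m)) ⟩
    m * (degree ℓ m C 2) + size Λ * ℓ + K Λ ∎
    where
    open ≡-Reasoning
    Λs = members Λ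
    Γs = members Γ
    crossK-↭ʳ : ∀ As {Bs Cs} → Bs ↭ Cs → crossK As Bs ≡ crossK {m} As Cs
    crossK-↭ʳ []       q = refl
    crossK-↭ʳ (A ∷ As) q = cong₂ _+_ (overlaps-↭ A q) (crossK-↭ʳ As q)
    rearrange : ∀ g k s x → g + (2 * k + s + x) ≡ k + x + g + s + k
    rearrange = solve-∀

  -- Complementation exchanges families of the size of `Λ` with families of the size of `Γ`, and by
  -- `K-complementary` it shifts `K` by an amount depending on the size only. The maxima are
  -- therefore shifted by the same amount; each inequality takes a maximiser on one side and
  -- complements it.
  maxK-complementary : ∀ {ℓ m} (Λ Γ : Family ℓ m) → Complementary Λ Γ →
    maxK (size Γ) ℓ m + size Λ * (ℓ * degree ℓ m)
      ≡ m * (degree ℓ m C 2) + size Λ * ℓ + maxK (size Λ) ℓ m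
  maxK-complementary {ℓ} {m} Λ Γ p = ≤-antisym upper lower
    where
    open ≤-Reasoning
    c = m * (degree ℓ m C 2) + size Λ * ℓ
    complement-size : ∀ (Δ Ε Δ′ Ε′ : Family ℓ m) → Complementary Δ Ε → Complementary Δ′ Ε′ →
                      size Δ ≡ size Δ′ → size Ε ≡ size Ε′
    complement-size Δ Ε Δ′ Ε′ q q′ e = +-cancelˡ-≡ (size Δ) _ _
      (trans (size-complementary Δ Ε q)
             (sym (trans (cong (_+ size Ε′) e) (size-complementary Δ′ Ε′ q′))))
    upper : maxK (size Γ) ℓ m + size Λ * (ℓ * degree ℓ m) ≤ c + maxK (size Λ) ℓ m
    upper with maxK-attained Γ
    ... | Γ′ , size≡ , K≡ = begin
      maxK (size Γ) ℓ m + size Λ * (ℓ * degree ℓ m)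
        ≡⟨ cong₂ (λ x r → x + r * (ℓ * degree ℓ m)) (sym K≡) r≡ ⟩
      K Γ′ + size Λ′ * (ℓ * degree ℓ m)
        ≡⟨ K-complementary Λ′ Γ′ p′ ⟩
      m * (degree ℓ m C 2) + size Λ′ * ℓ + K Λ′
        ≤⟨ +-monoʳ-≤ _ (K≤maxK Λ′) ⟩
      m * (degree ℓ m C 2) + size Λ′ * ℓ + maxK (size Λ′) ℓ m
        ≡⟨ cong (λ r → m * (degree ℓ m C 2) + r * ℓ + maxK r ℓ m) (sym r≡) ⟩
      c + maxK (size Λ) ℓ m ∎
      where
      Λ′ = Γ′ ᶜ
      -- The maximiser `Γ′` stands second, so that `K-complementary` is written in terms of
      -- `size Λ′`, which equals `size Λ`.
      p′ = Complementary-sym Γ′ Λ′ (ᶜ-complementary Γ′)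
      r≡ : size Λ ≡ size Λ′
      r≡ = complement-size Γ Λ Γ′ Λ′ (Complementary-sym Λ Γ p) (ᶜ-complementary Γ′) (sym size≡)
    lower : c + maxK (size Λ) ℓ m ≤ maxK (size Γ) ℓ m + size Λ * (ℓ * degree ℓ m)
    lower with maxK-attained Λ
    ... | Λ′ , size≡ , K≡ = begin
      c + maxK (size Λ) ℓ m
        ≡⟨ cong₂ (λ r x → m * (degree ℓ m C 2) + r * ℓ + x) (sym size≡) (sym K≡) ⟩
      m * (degree ℓ m C 2) + size Λ′ * ℓ + K Λ′
        ≡⟨ K-complementary Λ′ Γ′ (ᶜ-complementary Λ′) ⟨
      K Γ′ + size Λ′ * (ℓ * degree ℓ m)
        ≤⟨ +-monoˡ-≤ _ (K≤maxK Γ′) ⟩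
      maxK (size Γ′) ℓ m + size Λ′ * (ℓ * degree ℓ m)
        ≡⟨ cong₂ (λ s r → maxK s ℓ m + r * (ℓ * degree ℓ m))
                 (complement-size Λ′ Γ′ Λ Γ (ᶜ-complementary Λ′) p size≡) size≡ ⟩
      maxK (size Γ) ℓ m + size Λ * (ℓ * degree ℓ m) ∎
      where Γ′ = Λ′ ᶜ

  -- `K` and `maxK` satisfy the same relation between `Λ` and `Λ ᶜ`, with the same constants `c` and
  -- `d`, so equality on one side forces equality on the other by cancellation.
  Subclose-ᶜ : ∀ {ℓ m} (Λ : Family ℓ m) → Subclose Λ ⇔ Subclose (Λ ᶜ)
  Subclose-ᶜ {ℓ} {m} Λ = mk⇔
    (λ e → +-cancelʳ-≡ _ _ _ (trans K-eq (trans (cong (c +_) e) (sym maxK-eq))))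
    (λ e → +-cancelˡ-≡ c _ _ (trans (sym K-eq) (trans (cong (_+ d) e) maxK-eq)))
    where
    c = m * (degree ℓ m C 2) + size Λ * ℓ
    d = size Λ * (ℓ * degree ℓ m)
    K-eq = K-complementary Λ (Λ ᶜ) (ᶜ-complementary Λ)
    maxK-eq = maxK-complementary Λ (Λ ᶜ) (ᶜ-complementary Λ)

  -- The relation between maxima for every size `r ≤ k`.

  -- A witness that families of each size `r ≤ m C ℓ` exist, since `maxK-complementary` speaks of
  -- sizes of actual families.
  initialFamily : ℕ → ∀ ℓ m → Family ℓ m
  initialFamily r ℓ m = record
    { members  = take r (I ℓ m)
    ; distinct = Unique.take⁺ r (I-unique ℓ m)
    ; sizes    = All.take⁺ r (I-sizes ℓ m)
    }

  size-initialFamily : ∀ {r ℓ m} → r ≤ m C ℓ → size (initialFamily r ℓ m) ≡ r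
  size-initialFamily {r} {ℓ} {m} r≤k = trans (length-take r (I ℓ m))
    (m≤n⇒m⊓n≡m (subst (r ≤_) (sym (length-I ℓ m)) r≤k))

  maxK-∸ : ∀ {r ℓ m} → r ≤ m C ℓ →
    maxK (m C ℓ ∸ r) ℓ m + r * (ℓ * degree ℓ m)
      ≡ m * (degree ℓ m C 2) + r * ℓ + maxK r ℓ m
  maxK-∸ {r} {ℓ} {m} r≤k =
    subst (λ s → maxK (m C ℓ ∸ s) ℓ m + s * (ℓ * degree ℓ m)
                   ≡ m * (degree ℓ m C 2) + s * ℓ + maxK s ℓ m)
          (size-initialFamily r≤k)
          (subst (λ s → maxK s ℓ m + size Λ * (ℓ * degree ℓ m)
                          ≡ m * (degree ℓ m C 2) + size Λ * ℓ + maxK (size Λ) ℓ m)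
                 sizeᶜ
                 (maxK-complementary Λ (Λ ᶜ) (ᶜ-complementary Λ)))
    where
    Λ = initialFamily r ℓ m
    sizeᶜ : size (Λ ᶜ) ≡ m C ℓ ∸ size Λ
    sizeᶜ = trans (sym (m+n∸m≡n (size Λ) _))
                  (cong (_∸ size Λ) (size-complementary Λ (Λ ᶜ) (ᶜ-complementary Λ)))

-- Passage to the integers.

open import Data.Nat using (suc)
open import Data.Integer using (+_; 1ℤ; _+_; _-_; _*_)
open import Data.Integer.Properties using (pos-*)
open import Data.Integer.Tactic.RingSolver using (solve-∀)
import Data.Nat as ℕ
open import Relation.Binary.PropositionalEquality using (trans; cong; module ≡-Reasoning)
open Counting using (Subclose-ᶜ; K-complementary; ᶜ-complementary; maxK-∸)

-- Solving for `x` has to take place in the integers: for `r = k` the subtracted term is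
-- `m * ν * (ν - 1)`, twice `m * (ν C 2)`, so truncated subtraction would give a wrong value once
-- `ν > 1`.
transpose-ℤ : ∀ r ℓ ν a x y →
  x ℕ.+ r ℕ.* (ℓ ℕ.* ν) ≡ a ℕ.+ r ℕ.* ℓ ℕ.+ y →
  + x ≡ + a - + r * + ℓ * (+ ν - 1ℤ) + + y
transpose-ℤ r ℓ ν a x y eq = begin
  + x
    ≡⟨ add-sub (+ x) (+ r * (+ ℓ * + ν)) ⟩
  (+ x + + r * (+ ℓ * + ν)) - + r * (+ ℓ * + ν)
    ≡⟨ cong (_- + r * (+ ℓ * + ν)) eqℤ ⟩
  (+ a + + r * + ℓ + + y) - + r * (+ ℓ * + ν)
    ≡⟨ rearrange (+ a) (+ r) (+ ℓ) (+ ν) (+ y) ⟩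
  + a - + r * + ℓ * (+ ν - 1ℤ) + + y ∎
  where
  open ≡-Reasoning
  add-sub : ∀ x z → x ≡ (x + z) - z
  add-sub = solve-∀
  rearrange : ∀ a r l n y → (a + r * l + y) - r * (l * n) ≡ a - r * l * (n - 1ℤ) + y
  rearrange = solve-∀
  eqℤ : + x + + r * (+ ℓ * + ν) ≡ + a + + r * + ℓ + + y
  eqℤ = begin
    + x + + r * (+ ℓ * + ν)           ≡⟨ cong (λ z → + x + + r * z) (pos-* ℓ ν) ⟨
    + x + + r * + (ℓ ℕ.* ν)           ≡⟨ cong (λ z → + x + z) (pos-* r (ℓ ℕ.* ν)) ⟨
    + (x ℕ.+ r ℕ.* (ℓ ℕ.* ν))         ≡⟨ cong +_ eq ⟩
    + a + + (r ℕ.* ℓ) + + y           ≡⟨ cong (λ z → + a + z + + y) (pos-* r ℓ) ⟩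
    + a + + r * + ℓ + + y             ∎

proposition9 :
    (ℓ m : ℕ) → 1 ≤ ℓ → ℓ ≤ m →
    let k = m C ℓ
        ν = (m ∸ 1) C (ℓ ∸ 1)
    in
      ((Λ : Family ℓ m) →
        let r = size Λ in
          (Subclose Λ ⇔ Subclose (Λ ᶜ))
        × (+ K (Λ ᶜ) ≡ + m * + (ν C 2) - + r * + ℓ * (+ ν - 1ℤ) + + K Λ))
    × ((r : ℕ) → r ≤ k →
        + maxK (k ∸ r) ℓ m ≡ + m * + (ν C 2) - + r * + ℓ * (+ ν - 1ℤ) + + maxK r ℓ m)
-- With `ℓ` a successor, `degree` unfolds to the binomial coefficient `ν` of the statement, so the
-- counting identities apply directly.
proposition9 (suc ℓ) m _ _ =
    (λ Λ → Subclose-ᶜ Λ , toℤ (size Λ) (K-complementary Λ (Λ ᶜ) (ᶜ-complementary Λ)))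
  , (λ r r≤k → toℤ r (maxK-∸ r≤k))
  where
  ν = (m ∸ 1) C ℓ
  toℤ : ∀ r {x y} →
        x ℕ.+ r ℕ.* (suc ℓ ℕ.* ν) ≡ m ℕ.* (ν C 2) ℕ.+ r ℕ.* suc ℓ ℕ.+ y →
        + x ≡ + m * + (ν C 2) - + r * + suc ℓ * (+ ν - 1ℤ) + + y
  toℤ r {x} {y} eq =
    trans (transpose-ℤ r (suc ℓ) ν (m ℕ.* (ν C 2)) x y eq)
          (cong (λ z → z - + r * + suc ℓ * (+ ν - 1ℤ) + + y) (pos-* m (ν C 2)))
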